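{- Let $k$ be a field and let $A$ be a connected graded-commutative quadratic $k$-algebra. For a finite-dimensional subspace $W\subseteq A_1$ let $B_W:=\langle W\rangle_A$ be the graded subalgebra of $A$ generated by $W$. Assume that for every finite-dimensional subspace $W\subseteq A_1$ the subalgebra $B_W$ is a universally Koszul quadratic algebra. Then $A$ is the directed union of finite-type universally Koszul quadratic subalgebras.
   Context: A graded $k$-algebra $A=\bigoplus_{n\ge 0}A_n$ is connected if $A_0=k$; graded-commutative means $ab=(-1)^{mn}ba$ for $a\in A_m$, $b\in A_n$. A connected graded $k$-algebra generated in degree $1$ is quadratic if $A\cong T(V)/\langle R\rangle$ as graded algebras, where $V=A_1$ (possibly infinite-dimensional) and $R\subseteq V\otimes_k V$ is a subspace. A quadratic algebra $A$ is of finite type if $\dim_k A_1<\infty$. Universal Koszulity: let $A$ be a quadratic algebra with $\dim_k A_1<\infty$. Let $\mathcal L(A)$ be the set of graded left ideals $I\subseteq A$ with $I=A I_1$ (generated in degree $1$). $A$ is universally Koszul if for every $I\in\mathcal L(A)$ and every $x\in A_1\setminus I_1$, the colon ideal $I:x=\{a\in A\mid ax\in I\}$ belongs to $\mathcal L(A)$. -}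

module Defs where

open import Level using (Level) renaming (suc to lsuc)
open import Algebra.Bundles using (CommutativeMonoid; CommutativeRing; Ring; RawRing)
open import Algebra.Apartness.Bundles using (HeytingField; HeytingCommutativeRing)
open import Algebra.Definitions using (Inverse)
open import Algebra.Structures using (IsMonoid)
open import Algebra.Module.Bundles using (LeftModule)
open import Algebra.Module.Bundles.Raw using (RawLeftModule)
open import Algebra.Module.Structures using (IsLeftModule)
open import Algebra.Morphism.Structures using (IsRingIsomorphism; IsRingMonomorphism)
open import Algebra.Module.Morphism.Structures using (module LeftModuleMorphisms)
import Algebra.Module.Morphism.LeftModuleMonomorphism as LeftModuleMono
import Algebra.Module.Properties.LeftModule as LeftModuleProperties
import Algebra.Morphism.RingMonomorphism as RingMono
import Algebra.Properties.AbelianGroup as AbelianGroupProperties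
import Algebra.Properties.CommutativeSemigroup as CommutativeSemigroupProperties
import Algebra.Properties.CommutativeMonoid.Sum as Sum
import Algebra.Properties.Ring as RingProperties
import Algebra.Properties.Semiring.Exp as Exp
import Data.List.Membership.Setoid as Membership
import Relation.Binary.Reasoning.Setoid as ≈-Reasoning
open import Data.Fin.Base using (toℕ; suc)
open import Data.List.Base using (List)
open import Data.Nat.Base as ℕ using (ℕ; zero; suc)
open import Data.Product.Base using (Σ; Σ-syntax; ∃-syntax; ∃₂; _×_; _,_; proj₁; proj₂)
open import Data.Vec.Functional using (Vector)
open import Function.Base using (_∘_)
open import Function.Bundles using (_⇔_)
open import Relation.Binary.Definitions using (_Respects_)
open import Relation.Nullary.Negation using (¬_)
open import Relation.Unary using (Pred; _∈_; _⊆_; _∩_; _≐_)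

-- Everything lives in a single universe level ℓ, so that `Pred X ℓ` serves as
-- the power set of X and quotients and generated substructures stay at level ℓ.

module GradedAlgebras {ℓ : Level} (k : HeytingField ℓ ℓ ℓ) where

  module K = CommutativeRing
    (HeytingCommutativeRing.commutativeRing (HeytingField.heytingCommutativeRing k))

  VectorSpace : Set (lsuc ℓ)
  VectorSpace = LeftModule K.ring ℓ ℓ

  module _ (V : VectorSpace) where
    open LeftModule V

    record IsSubspace (P : Pred Carrierᴹ ℓ) : Set ℓ where
      field
        resp     : P Respects _≈ᴹ_
        0-closed : P 0ᴹ
        +-closed : ∀ {x y} → P x → P y → P (x +ᴹ y)
        *-closed : ∀ c {x} → P x → P (c *ₗ x)

    data Span (P : Pred Carrierᴹ ℓ) : Pred Carrierᴹ ℓ where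
      incl  : ∀ {x} → P x → Span P x
      resp∈  : Span P Respects _≈ᴹ_
      0∈    : Span P 0ᴹ
      _+∈_  : ∀ {x y} → Span P x → Span P y → Span P (x +ᴹ y)
      _*∈_  : ∀ c {x} → Span P x → Span P (c *ₗ x)

    -- Spanned by a finite list of vectors.  Over a field this is the usual
    -- notion; the list is not required to be linearly independent, since a basis
    -- cannot be extracted from it constructively.
    FiniteDimensional : Pred Carrierᴹ ℓ → Set ℓ
    FiniteDimensional P = ∃[ vs ] P ≐ Span (_∈ₗ vs)
      where open Membership ≈ᴹ-setoid renaming (_∈_ to _∈ₗ_)

  module _ (V : VectorSpace) where
    open LeftModule V
    open LeftModuleProperties V using (inverseʳ-uniqueᴹ)

    -1*ₗx≈-ᴹx : ∀ x → (K.- K.1#) *ₗ x ≈ᴹ -ᴹ x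
    -1*ₗx≈-ᴹx x = inverseʳ-uniqueᴹ x ((K.- K.1#) *ₗ x) (begin
      x +ᴹ (K.- K.1#) *ₗ x           ≈⟨ +ᴹ-congʳ (*ₗ-identityˡ x) ⟨
      K.1# *ₗ x +ᴹ (K.- K.1#) *ₗ x   ≈⟨ *ₗ-distribʳ x K.1# (K.- K.1#) ⟨
      (K.1# K.+ K.- K.1#) *ₗ x       ≈⟨ *ₗ-congʳ (K.-‿inverseʳ K.1#) ⟩
      K.0# *ₗ x                      ≈⟨ *ₗ-zeroˡ x ⟩
      0ᴹ                             ∎)
      where open ≈-Reasoning ≈ᴹ-setoid

    module _ {P : Pred Carrierᴹ ℓ} (P-isSubspace : IsSubspace V P) where
      private module P = IsSubspace P-isSubspace

      rawSubspace : RawLeftModule K.Carrier ℓ ℓ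
      rawSubspace = record
        { Carrierᴹ = Σ Carrierᴹ P
        ; _≈ᴹ_     = λ x y → proj₁ x ≈ᴹ proj₁ y
        ; _+ᴹ_     = λ (x , p) (y , q) → x +ᴹ y , P.+-closed p q
        ; _*ₗ_     = λ c (x , p) → c *ₗ x , P.*-closed c p
        ; 0ᴹ       = 0ᴹ , P.0-closed
        ; -ᴹ_      = λ (x , p) → -ᴹ x , P.resp (-1*ₗx≈-ᴹx x) (P.*-closed (K.- K.1#) p)
        }

      subspace : VectorSpace
      subspace = record
        { RawLeftModule rawSubspace
        ; isLeftModule = LeftModuleMono.isLeftModule inclusion K.isRing isLeftModule
        }
        where
        open LeftModuleMorphisms rawSubspace rawLeftModule
        inclusion : IsLeftModuleMonomorphism proj₁
        inclusion = record
          { isLeftModuleHomomorphism = record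
            { +ᴹ-isGroupHomomorphism = record
              { isMonoidHomomorphism = record
                { isMagmaHomomorphism = record
                  { isRelHomomorphism = record { cong = λ eq → eq }
                  ; homo = λ _ _ → ≈ᴹ-refl
                  }
                ; ε-homo = ≈ᴹ-refl
                }
              ; ⁻¹-homo = λ _ → ≈ᴹ-refl
              }
            ; *ₗ-homo = λ _ _ → ≈ᴹ-refl
            }
          ; injective = λ eq → eq
          }

  record Algebra : Set (lsuc ℓ) where
    infixr 7 _•_
    field
      ring : Ring ℓ ℓ
    open Ring ring public
    field
      _•_          : K.Carrier → Carrier → Carrier
      isLeftModule : IsLeftModule K.ring _≈_ _+_ 0# -_ _•_
      •-*-assoc    : ∀ c x y → (c • x) * y ≈ c • (x * y)
      *-•-comm     : ∀ c x y → x * (c • y) ≈ c • (x * y)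

    leftModule : VectorSpace
    leftModule = record { isLeftModule = isLeftModule }

    open IsLeftModule isLeftModule public using ()
      renaming ( *ₗ-cong to •-cong; *ₗ-zeroˡ to •-zeroˡ; *ₗ-zeroʳ to •-zeroʳ
               ; *ₗ-distribˡ to •-distribˡ; *ₗ-distribʳ to •-distribʳ
               ; *ₗ-identityˡ to •-identityˡ; *ₗ-assoc to •-assoc )

    open Sum +-commutativeMonoid public using (sum)

  module _ (A : Algebra) where
    open Algebra A

    -- Deg n is the homogeneous component Aₙ; `decompose` says A = Σ Aₙ and
    -- `independent` that this sum is direct.
    record IsGrading (Deg : ℕ → Pred Carrier ℓ) : Set ℓ where
      field
        isSubspace  : ∀ n → IsSubspace leftModule (Deg n)
        1-degree    : Deg 0 1#
        *-degree    : ∀ {m n x y} → Deg m x → Deg n y → Deg (m ℕ.+ n) (x * y)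
        decompose   : ∀ a → Span leftModule (λ x → ∃[ n ] Deg n x) a
        independent : ∀ {n} (f : Vector Carrier n) → (∀ i → Deg (toℕ i) (f i)) →
                      sum f ≈ 0# → ∀ i → f i ≈ 0#

    data Generated (S : Pred Carrier ℓ) : Pred Carrier ℓ where
      incl : ∀ {x} → S x → Generated S x
      resp∈ : Generated S Respects _≈_
      0∈   : Generated S 0#
      1∈   : Generated S 1#
      _+∈_ : ∀ {x y} → Generated S x → Generated S y → Generated S (x + y)
      _*∈_ : ∀ {x y} → Generated S x → Generated S y → Generated S (x * y)
      _•∈_ : ∀ c {x} → Generated S x → Generated S (c • x)

    data Ideal (S : Pred Carrier ℓ) : Pred Carrier ℓ where
      incl : ∀ {x} → S x → Ideal S x
      resp∈ : Ideal S Respects _≈_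
      0∈   : Ideal S 0#
      _+∈_ : ∀ {x y} → Ideal S x → Ideal S y → Ideal S (x + y)
      _*ˡ_ : ∀ a {x} → Ideal S x → Ideal S (a * x)
      _*ʳ_ : ∀ {x} → Ideal S x → ∀ a → Ideal S (x * a)

  module _ (A : Algebra) (S : Pred (Algebra.Carrier A) ℓ) where
    open Algebra A
    open AbelianGroupProperties +-abelianGroup
      using (⁻¹-anti-homo‿-; ⁻¹-∙-comm; x≈y⇒x∙y⁻¹≈ε)
    open CommutativeSemigroupProperties
      (CommutativeMonoid.commutativeSemigroup +-commutativeMonoid) using (interchange)
    open RingProperties ring using (x[y-z]≈xy-xz; [y-z]x≈yx-zx; -1*x≈-x)
    open ≈-Reasoning setoid
    private
      infix 4 _∼_
      _∼_ : Carrier → Carrier → Set ℓ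
      x ∼ y = Ideal A S (x - y)

      neg : ∀ {x} → Ideal A S x → Ideal A S (- x)
      neg {x} p = resp∈ (-1*x≈-x x) ((- 1#) *ˡ p)

      ≈⇒∼ : ∀ {x y} → x ≈ y → x ∼ y
      ≈⇒∼ eq = resp∈ (sym (x≈y⇒x∙y⁻¹≈ε eq)) 0∈

      ∼-sym : ∀ {x y} → x ∼ y → y ∼ x
      ∼-sym {x} {y} p = resp∈ (⁻¹-anti-homo‿- x y) (neg p)

      telescope : ∀ x y z → (x - y) + (y - z) ≈ x - z
      telescope x y z = begin
        (x - y) + (y - z)      ≈⟨ +-assoc x (- y) (y - z) ⟩
        x + (- y + (y - z))    ≈⟨ +-congˡ (+-assoc (- y) y (- z)) ⟨
        x + ((- y + y) - z)    ≈⟨ +-congˡ (+-congʳ (-‿inverseˡ y)) ⟩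
        x + (0# - z)           ≈⟨ +-congˡ (+-identityˡ (- z)) ⟩
        x - z                  ∎

      ∼-trans : ∀ {x y z} → x ∼ y → y ∼ z → x ∼ z
      ∼-trans {x} {y} {z} p q = resp∈ (telescope x y z) (p +∈ q)

      +-cong∼ : ∀ {x y u v} → x ∼ y → u ∼ v → x + u ∼ y + v
      +-cong∼ {x} {y} {u} {v} p q = resp∈
        (trans (interchange x (- y) u (- v)) (+-congˡ (⁻¹-∙-comm y v))) (p +∈ q)

      *-cong∼ : ∀ {x y u v} → x ∼ y → u ∼ v → x * u ∼ y * v
      *-cong∼ {x} {y} {u} {v} p q = ∼-trans
        (resp∈ ([y-z]x≈yx-zx u x y) (p *ʳ u))
        (resp∈ (x[y-z]≈xy-xz y u v) (y *ˡ q))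

      -‿cong∼ : ∀ {x y} → x ∼ y → - x ∼ - y
      -‿cong∼ {x} {y} p = resp∈ (sym (⁻¹-∙-comm x (- y))) (neg p)

      •-cong∼ : ∀ {c d x y} → c K.≈ d → x ∼ y → c • x ∼ d • y
      •-cong∼ {c} {d} {x} {y} c≈d p = ∼-trans
        (≈⇒∼ (trans (•-cong c≈d refl) (scalar x)))
        (∼-trans (*-cong∼ (≈⇒∼ refl) p) (≈⇒∼ (sym (scalar y))))
        where
        scalar : ∀ z → d • z ≈ (d • 1#) * z
        scalar z = sym (trans (•-*-assoc d 1# z) (•-cong K.refl (*-identityˡ z)))

    quotient : Algebra
    quotient = record
      { ring = record
        { Carrier = Carrier ; _≈_ = _∼_ ; _+_ = _+_ ; _*_ = _*_ ; -_ = -_ ; 0# = 0# ; 1# = 1#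
        ; isRing = record
          { +-isAbelianGroup = record
            { isGroup = record
              { isMonoid = +-monoid∼
              ; inverse  = (λ x → ≈⇒∼ (-‿inverseˡ x)) , (λ x → ≈⇒∼ (-‿inverseʳ x))
              ; ⁻¹-cong  = -‿cong∼
              }
            ; comm = λ x y → ≈⇒∼ (+-comm x y)
            }
          ; *-cong     = *-cong∼
          ; *-assoc    = λ x y z → ≈⇒∼ (*-assoc x y z)
          ; *-identity = (λ x → ≈⇒∼ (*-identityˡ x)) , (λ x → ≈⇒∼ (*-identityʳ x))
          ; distrib    = (λ x y z → ≈⇒∼ (distribˡ x y z)) , (λ x y z → ≈⇒∼ (distribʳ x y z))
          }
        }
      ; _•_ = _•_
      ; isLeftModule = record
        { isLeftSemimodule = record
          { +ᴹ-isCommutativeMonoid = record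
            { isMonoid = +-monoid∼
            ; comm     = λ x y → ≈⇒∼ (+-comm x y)
            }
          ; isPreleftSemimodule = record
            { *ₗ-cong      = •-cong∼
            ; *ₗ-zeroˡ     = λ x → ≈⇒∼ (•-zeroˡ x)
            ; *ₗ-distribʳ  = λ x c d → ≈⇒∼ (•-distribʳ x c d)
            ; *ₗ-identityˡ = λ x → ≈⇒∼ (•-identityˡ x)
            ; *ₗ-assoc     = λ c d x → ≈⇒∼ (•-assoc c d x)
            ; *ₗ-zeroʳ     = λ c → ≈⇒∼ (•-zeroʳ c)
            ; *ₗ-distribˡ  = λ c x y → ≈⇒∼ (•-distribˡ c x y)
            }
          }
        ; -ᴹ‿cong    = -‿cong∼
        ; -ᴹ‿inverse = (λ x → ≈⇒∼ (-‿inverseˡ x)) , (λ x → ≈⇒∼ (-‿inverseʳ x))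
        }
      ; •-*-assoc = λ c x y → ≈⇒∼ (•-*-assoc c x y)
      ; *-•-comm  = λ c x y → ≈⇒∼ (*-•-comm c x y)
      }
      where
      +-monoid∼ : IsMonoid _∼_ _+_ 0#
      +-monoid∼ = record
        { isSemigroup = record
          { isMagma = record
            { isEquivalence = record { refl = ≈⇒∼ refl ; sym = ∼-sym ; trans = ∼-trans }
            ; ∙-cong        = +-cong∼
            }
          ; assoc = λ x y z → ≈⇒∼ (+-assoc x y z)
          }
        ; identity = (λ x → ≈⇒∼ (+-identityˡ x)) , (λ x → ≈⇒∼ (+-identityʳ x))
        }

  -- The tensor algebra as the free k-algebra on V: terms modulo the congruence
  -- generated by the algebra axioms and the linearity of ι : V → T(V).
  module Tensor (V : VectorSpace) where
    open LeftModule V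

    infixl 6 _⊕_
    infixl 7 _⊛_
    infixr 7 _·_
    infix  8 ⊖_
    data T : Set ℓ where
      ι       : Carrierᴹ → T
      _⊕_ _⊛_ : T → T → T
      ⊖_      : T → T
      _·_     : K.Carrier → T → T
      𝟘 𝟙     : T

    infix 4 _≋_
    data _≋_ : T → T → Set ℓ where
      ι-cong  : ∀ {v w} → v ≈ᴹ w → ι v ≋ ι w
      ι-+     : ∀ v w → ι (v +ᴹ w) ≋ ι v ⊕ ι w
      ι-·     : ∀ c v → ι (c *ₗ v) ≋ c · ι v
      refl    : ∀ {x} → x ≋ x
      sym     : ∀ {x y} → x ≋ y → y ≋ x
      trans   : ∀ {x y z} → x ≋ y → y ≋ z → x ≋ z
      ⊕-cong  : ∀ {x y u v} → x ≋ y → u ≋ v → x ⊕ u ≋ y ⊕ v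
      ⊛-cong  : ∀ {x y u v} → x ≋ y → u ≋ v → x ⊛ u ≋ y ⊛ v
      ⊖-cong  : ∀ {x y} → x ≋ y → ⊖ x ≋ ⊖ y
      ·-cong  : ∀ {c d x y} → c K.≈ d → x ≋ y → c · x ≋ d · y
      ⊕-assoc : ∀ x y z → (x ⊕ y) ⊕ z ≋ x ⊕ (y ⊕ z)
      ⊕-comm  : ∀ x y → x ⊕ y ≋ y ⊕ x
      ⊕-idˡ   : ∀ x → 𝟘 ⊕ x ≋ x
      ⊖-invˡ  : ∀ x → ⊖ x ⊕ x ≋ 𝟘
      ⊛-assoc : ∀ x y z → (x ⊛ y) ⊛ z ≋ x ⊛ (y ⊛ z)
      ⊛-idˡ   : ∀ x → 𝟙 ⊛ x ≋ x
      ⊛-idʳ   : ∀ x → x ⊛ 𝟙 ≋ x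
      distˡ   : ∀ x y z → x ⊛ (y ⊕ z) ≋ x ⊛ y ⊕ x ⊛ z
      distʳ   : ∀ x y z → (y ⊕ z) ⊛ x ≋ y ⊛ x ⊕ z ⊛ x
      ·-zeroˡ : ∀ x → K.0# · x ≋ 𝟘
      ·-zeroʳ : ∀ c → c · 𝟘 ≋ 𝟘
      ·-idˡ   : ∀ x → K.1# · x ≋ x
      ·-assoc : ∀ c d x → (c K.* d) · x ≋ c · d · x
      ·-distˡ : ∀ c x y → c · (x ⊕ y) ≋ c · x ⊕ c · y
      ·-distʳ : ∀ x c d → (c K.+ d) · x ≋ c · x ⊕ d · x
      ·-⊛     : ∀ c x y → (c · x) ⊛ y ≋ c · (x ⊛ y)
      ⊛-·     : ∀ c x y → x ⊛ (c · y) ≋ c · (x ⊛ y)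

    tensorAlgebra : Algebra
    tensorAlgebra = record
      { ring = record
        { Carrier = T ; _≈_ = _≋_ ; _+_ = _⊕_ ; _*_ = _⊛_ ; -_ = ⊖_ ; 0# = 𝟘 ; 1# = 𝟙
        ; isRing = record
          { +-isAbelianGroup = record
            { isGroup = record { isMonoid = ⊕-monoid ; inverse = ⊖-inv ; ⁻¹-cong = ⊖-cong }
            ; comm = ⊕-comm
            }
          ; *-cong = ⊛-cong ; *-assoc = ⊛-assoc
          ; *-identity = ⊛-idˡ , ⊛-idʳ ; distrib = distˡ , distʳ
          }
        }
      ; _•_ = _·_
      ; isLeftModule = record
        { isLeftSemimodule = record
          { +ᴹ-isCommutativeMonoid = record { isMonoid = ⊕-monoid ; comm = ⊕-comm }
          ; isPreleftSemimodule = record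
            { *ₗ-cong = ·-cong ; *ₗ-zeroˡ = ·-zeroˡ ; *ₗ-zeroʳ = ·-zeroʳ
            ; *ₗ-identityˡ = ·-idˡ ; *ₗ-assoc = ·-assoc
            ; *ₗ-distribˡ = ·-distˡ ; *ₗ-distribʳ = ·-distʳ
            }
          }
        ; -ᴹ‿cong = ⊖-cong
        ; -ᴹ‿inverse = ⊖-inv
        }
      ; •-*-assoc = ·-⊛
      ; *-•-comm  = ⊛-·
      }
      where
      ⊕-monoid : IsMonoid _≋_ _⊕_ 𝟘
      ⊕-monoid = record
        { isSemigroup = record
          { isMagma = record
            { isEquivalence = record { refl = refl ; sym = sym ; trans = trans }
            ; ∙-cong        = ⊕-cong
            }
          ; assoc = ⊕-assoc
          }
        ; identity = ⊕-idˡ , (λ x → trans (⊕-comm x 𝟘) (⊕-idˡ x))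
        }
      ⊖-inv : Inverse _≋_ 𝟘 ⊖_ _⊕_
      ⊖-inv = ⊖-invˡ , (λ x → trans (⊕-comm x (⊖ x)) (⊖-invˡ x))

    data Word : ℕ → Pred T ℓ where
      nil  : Word 0 𝟙
      cons : ∀ {n t} v → Word n t → Word (suc n) (ι v ⊛ t)

    -- The component V^{⊗n} of T(V); in particular T² is V ⊗ V.
    T^ : ℕ → Pred T ℓ
    T^ n = Span (Algebra.leftModule tensorAlgebra) (Word n)

    module _ (R : Pred T ℓ) where
      T/⟨_⟩ : Algebra
      T/⟨_⟩ = quotient tensorAlgebra R

      T/⟨_⟩-Deg : ℕ → Pred T ℓ
      T/⟨_⟩-Deg n x = ∃[ t ] T^ n t × Algebra._≈_ T/⟨_⟩ x t

  record GradedAlgebra : Set (lsuc ℓ) where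
    field
      algebra   : Algebra
    open Algebra algebra public
    field
      Deg       : ℕ → Pred Carrier ℓ
      isGrading : IsGrading algebra Deg
    open IsGrading isGrading public

    Homogeneous : Pred Carrier ℓ
    Homogeneous x = ∃[ n ] Deg n x

    -- For a subspace P this says P = ⊕ₙ (P ∩ Aₙ).
    IsGraded : Pred Carrier ℓ → Set ℓ
    IsGraded P = P ⊆ Span leftModule (P ∩ Homogeneous)

  -- The degree predicates need not be known to be gradings: if one of them is, and
  -- the other one respects equality,
  -- then the isomorphism makes the latter a grading too.
  record GradedIsomorphism
    (A : Algebra) (Deg₁ : ℕ → Pred (Algebra.Carrier A) ℓ)
    (B : Algebra) (Deg₂ : ℕ → Pred (Algebra.Carrier B) ℓ) : Set ℓ where
    private
      module A = Algebra A
      module B = Algebra B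
    field
      to                : A.Carrier → B.Carrier
      isRingIsomorphism : IsRingIsomorphism A.rawRing B.rawRing to
      •-homo            : ∀ c x → to (c A.• x) B.≈ c B.• to x
      degree            : ∀ n x → Deg₁ n x ⇔ Deg₂ n (to x)

  module _ (A : GradedAlgebra) where
    open GradedAlgebra A

    record IsConnected : Set ℓ where
      field
        injective  : ∀ c → c • 1# ≈ 0# → c K.≈ K.0#
        surjective : ∀ {x} → Deg 0 x → ∃[ c ] c • 1# ≈ x

    GradedCommutative : Set ℓ
    GradedCommutative = ∀ {m n a b} → Deg m a → Deg n b →
      a * b ≈ ((K.- K.1#) ^ (m ℕ.* n)) • (b * a)
      where open Exp K.semiring using (_^_)

    GeneratedInDegree1 : Set ℓ
    GeneratedInDegree1 = ∀ a → Generated algebra (Deg 1) a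

    A₁ : VectorSpace
    A₁ = subspace leftModule (isSubspace 1)

    record IsQuadratic : Set (lsuc ℓ) where
      open Tensor A₁
      field
        connected          : IsConnected
        generatedInDegree1 : GeneratedInDegree1
        R                  : Pred T ℓ
        R-isSubspace       : IsSubspace (Algebra.leftModule tensorAlgebra) R
        R⊆V⊗V              : R ⊆ T^ 2
        A≅T/⟨R⟩            : GradedIsomorphism algebra Deg T/⟨ R ⟩ T/⟨ R ⟩-Deg

    FiniteType : Set ℓ
    FiniteType = FiniteDimensional leftModule (Deg 1)

    record IsLeftIdeal (I : Pred Carrier ℓ) : Set ℓ where
      field
        resp     : I Respects _≈_
        0-closed : I 0#
        +-closed : ∀ {x y} → I x → I y → I (x + y)
        *-closed : ∀ a {x} → I x → I (a * x)

    A·_ : Pred Carrier ℓ → Pred Carrier ℓ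
    A· S = Span leftModule (λ z → ∃₂ λ a s → S s × z ≈ a * s)

    record 𝓛 (I : Pred Carrier ℓ) : Set ℓ where
      field
        isLeftIdeal : IsLeftIdeal I
        isGraded    : IsGraded I
        generated   : I ≐ A· (I ∩ Deg 1)

    _∶_ : Pred Carrier ℓ → Carrier → Pred Carrier ℓ
    (I ∶ x) a = I (a * x)

    -- Quadraticity and finite type are separate conditions, not part of this one.
    UniversallyKoszul : Set (lsuc ℓ)
    UniversallyKoszul = ∀ I → 𝓛 I → ∀ x → Deg 1 x → ¬ (I ∩ Deg 1) x → 𝓛 (I ∶ x)

    record GradedSubalgebra : Set (lsuc ℓ) where
      field
        Member     : Pred Carrier ℓ
        isSubspace : IsSubspace leftModule Member
        1-closed   : Member 1#
        *-closed   : ∀ {x y} → Member x → Member y → Member (x * y)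
        isGraded   : IsGraded Member

  module _ {A : GradedAlgebra} (B : GradedSubalgebra A) where
    private
      module A = GradedAlgebra A
      module B = GradedSubalgebra B
      module S = IsSubspace B.isSubspace

      BMod = subspace A.leftModule B.isSubspace
      module BMod = LeftModule BMod

      rawRing : RawRing ℓ ℓ
      rawRing = record
        { Carrier = BMod.Carrierᴹ
        ; _≈_     = BMod._≈ᴹ_
        ; _+_     = BMod._+ᴹ_
        ; _*_     = λ (x , p) (y , q) → x A.* y , B.*-closed p q
        ; -_      = BMod.-ᴹ_
        ; 0#      = BMod.0ᴹ
        ; 1#      = A.1# , B.1-closed
        }

      inclusion : IsRingMonomorphism rawRing A.rawRing proj₁
      inclusion = record
        { isRingHomomorphism = record
          { isSemiringHomomorphism = record
            { isNearSemiringHomomorphism = record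
              { +-isMonoidHomomorphism = record
                { isMagmaHomomorphism = record
                  { isRelHomomorphism = record { cong = λ eq → eq }
                  ; homo = λ _ _ → A.refl
                  }
                ; ε-homo = A.refl
                }
              ; *-homo = λ _ _ → A.refl
              }
            ; 1#-homo = A.refl
            }
          ; -‿homo = λ _ → A.refl
          }
        ; injective = λ eq → eq
        }

      BAlg : Algebra
      BAlg = record
        { ring         = record { RawRing rawRing ; isRing = RingMono.isRing inclusion A.isRing }
        ; _•_          = BMod._*ₗ_
        ; isLeftModule = BMod.isLeftModule
        ; •-*-assoc    = λ c x y → A.•-*-assoc c (proj₁ x) (proj₁ y)
        ; *-•-comm     = λ c x y → A.*-•-comm c (proj₁ x) (proj₁ y)
        }
      module BAlg = Algebra BAlg

      lift : ∀ {x} → Span A.leftModule (B.Member ∩ A.Homogeneous) x →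
             Σ[ p ∈ B.Member x ] Span BMod (A.Homogeneous ∘ proj₁) (x , p)
      lift (incl (p , h)) = p , incl h
      lift (resp∈ x≈y s) with lift s
      ... | p , t = S.resp x≈y p , resp∈ x≈y t
      lift 0∈ = S.0-closed , 0∈
      lift (s +∈ t) with lift s | lift t
      ... | p , s′ | q , t′ = S.+-closed p q , s′ +∈ t′
      lift (c *∈ s) with lift s
      ... | p , t = S.*-closed c p , c *∈ t

      proj₁-sum : ∀ {n} (f : Vector BAlg.Carrier n) →
                  proj₁ (BAlg.sum f) A.≈ A.sum (proj₁ ∘ f)
      proj₁-sum {zero}  f = A.refl
      proj₁-sum {suc n} f = A.+-congˡ (proj₁-sum (f ∘ suc))

    asGradedAlgebra : GradedAlgebra
    asGradedAlgebra = record
      { algebra   = BAlg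
      ; Deg       = λ n → A.Deg n ∘ proj₁
      ; isGrading = record
        { isSubspace = λ n → let module D = IsSubspace (A.isSubspace n) in record
          { resp = D.resp ; 0-closed = D.0-closed
          ; +-closed = D.+-closed ; *-closed = λ c → D.*-closed c }
        ; 1-degree    = A.1-degree
        ; *-degree    = A.*-degree
        ; decompose   = λ (x , p) → resp∈ A.refl (proj₂ (lift (B.isGraded p)))
        ; independent = λ f d eq →
            A.independent (proj₁ ∘ f) d (A.trans (A.sym (proj₁-sum f)) eq)
        }
      }

  module _ (A : GradedAlgebra) (W : Pred (GradedAlgebra.Carrier A) ℓ)
           (W⊆A₁ : W ⊆ GradedAlgebra.Deg A 1) where
    open GradedAlgebra A
    private
      G H : Pred Carrier ℓ
      G = Generated algebra W
      H = Span leftModule (G ∩ Homogeneous)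

      H-*ˡ : ∀ {x y} → G x × Homogeneous x → H y → H (x * y)
      H-*ˡ (p , m , d) (incl (q , n , e)) = incl (p *∈ q , m ℕ.+ n , *-degree d e)
      H-*ˡ h (resp∈ eq t) = resp∈ (*-congˡ eq) (H-*ˡ h t)
      H-*ˡ h 0∈ = resp∈ (sym (zeroʳ _)) 0∈
      H-*ˡ h (s +∈ t) = resp∈ (sym (distribˡ _ _ _)) (H-*ˡ h s +∈ H-*ˡ h t)
      H-*ˡ h (c *∈ t) = resp∈ (sym (*-•-comm c _ _)) (c *∈ H-*ˡ h t)

      H-* : ∀ {x y} → H x → H y → H (x * y)
      H-* (incl h) t = H-*ˡ h t
      H-* (resp∈ eq s) t = resp∈ (*-congʳ eq) (H-* s t)
      H-* 0∈ t = resp∈ (sym (zeroˡ _)) 0∈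
      H-* (s +∈ s′) t = resp∈ (sym (distribʳ _ _ _)) (H-* s t +∈ H-* s′ t)
      H-* (c *∈ s) t = resp∈ (sym (•-*-assoc c _ _)) (c *∈ H-* s t)

      G⊆H : G ⊆ H
      G⊆H (incl w) = incl (incl w , 1 , W⊆A₁ w)
      G⊆H (resp∈ eq p) = resp∈ eq (G⊆H p)
      G⊆H 0∈ = 0∈
      G⊆H 1∈ = incl (1∈ , 0 , 1-degree)
      G⊆H (p +∈ q) = G⊆H p +∈ G⊆H q
      G⊆H (p *∈ q) = H-* (G⊆H p) (G⊆H q)
      G⊆H (c •∈ p) = c *∈ G⊆H p

    generatedSubalgebra : GradedSubalgebra A
    generatedSubalgebra = record
      { Member     = G
      ; isSubspace = record { resp = resp∈ ; 0-closed = 0∈ ; +-closed = _+∈_ ; *-closed = _•∈_ }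
      ; 1-closed   = 1∈
      ; *-closed   = _*∈_
      ; isGraded   = G⊆H
      }

  record IsDirectedUnion (A : GradedAlgebra) {I : Set ℓ} (B : I → GradedSubalgebra A) : Set ℓ where
    open GradedSubalgebra
    field
      nonempty : I
      directed : ∀ i j → ∃[ l ] (Member (B i) ⊆ Member (B l)) × (Member (B j) ⊆ Member (B l))
      covers   : ∀ a → ∃[ i ] Member (B i) a

{-# OPTIONS --safe #-}
module Submission where

open import Defs
open import Algebra.Apartness.Bundles using (HeytingField)
open import Data.Product.Base using (_×_; Σ-syntax)
open import Level using (Level)
open import Relation.Unary using (Pred; _⊆_)

open import Algebra.Module.Bundles using (LeftModule)
import Algebra.Properties.AbelianGroup as AbelianGroupProperties
import Algebra.Properties.CommutativeMonoid.Sum as Sum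
open import Data.Fin.Base using (toℕ; fromℕ<)
open import Data.Fin.Properties using (toℕ-fromℕ<)
open import Data.List.Base using (List; []; _∷_; _++_; [_])
import Data.List.Membership.Setoid as Membership
open import Data.List.Membership.Setoid.Properties using (∈-++⁺ˡ; ∈-++⁺ʳ)
open import Data.List.Relation.Unary.All as All using (All; []; _∷_)
open import Data.List.Relation.Unary.All.Properties using (++⁺)
open import Data.List.Relation.Unary.Any using (here; there)
open import Data.Nat.Base as ℕ using (ℕ; zero; suc; _⊔_; s≤s)
open import Data.Nat.Properties using (≤-trans; m≤m⊔n; m≤n⊔m)
open import Data.Product.Base using (∃-syntax; _,_; proj₁; proj₂)
open import Function.Base using (id; _∘_)
import Relation.Binary.PropositionalEquality.Core as ≡

-- A is the union of the subalgebras generated by finite lists of elements of A₁,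
-- and concatenation of lists makes this union directed.  Only finite type is not
-- immediate: the degree-1 part of ⟨W⟩ has to be W itself.  The family E with
-- E₀ = A₀, E₁ = W and Eₙ = Aₙ for n ≥ 2 is multiplicative (for E₀E₁ ⊆ E₁ because
-- A₀ = k), so ⟨W⟩ lies in the sum of the Eₙ, and directness of A = ⊕ Aₙ makes the
-- degree-1 component of every element of that sum an element of W.

module _ {ℓ : Level} (k : HeytingField ℓ ℓ ℓ) where
  open GradedAlgebras k

  -- Spans, and their transport into a subspace.

  module _ (V : VectorSpace) where
    open LeftModule V

    Span-isSubspace : ∀ P → IsSubspace V (Span V P)
    Span-isSubspace P = record
      { resp = resp∈ ; 0-closed = 0∈ ; +-closed = _+∈_ ; *-closed = _*∈_ }

    Span-least : ∀ {P Q} → IsSubspace V Q → P ⊆ Q → Span V P ⊆ Q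
    Span-least Q-sub P⊆Q (incl p)       = P⊆Q p
    Span-least Q-sub P⊆Q (resp∈ eq s)   = IsSubspace.resp Q-sub eq (Span-least Q-sub P⊆Q s)
    Span-least Q-sub P⊆Q 0∈             = IsSubspace.0-closed Q-sub
    Span-least Q-sub P⊆Q (s +∈ t)       =
      IsSubspace.+-closed Q-sub (Span-least Q-sub P⊆Q s) (Span-least Q-sub P⊆Q t)
    Span-least Q-sub P⊆Q (c *∈ s)       = IsSubspace.*-closed Q-sub c (Span-least Q-sub P⊆Q s)

    Span-mono : ∀ {P Q} → P ⊆ Q → Span V P ⊆ Span V Q
    Span-mono P⊆Q = Span-least (Span-isSubspace _) (incl ∘ P⊆Q)

    open Membership ≈ᴹ-setoid renaming (_∈_ to _∈ₗ_)

    All-∈ : ∀ {P vs} → IsSubspace V P → All P vs → (_∈ₗ vs) ⊆ P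
    All-∈ P-sub (p ∷ _)  (here x≈v) = IsSubspace.resp P-sub (≈ᴹ-sym x≈v) p
    All-∈ P-sub (_ ∷ ps) (there x∈) = All-∈ P-sub ps x∈

    module _ {P : Pred Carrierᴹ ℓ} (P-sub : IsSubspace V P) where
      private
        P-space = subspace V P-sub
        module P = IsSubspace P-sub

      open Membership (LeftModule.≈ᴹ-setoid P-space) using () renaming (_∈_ to _∈ₚ_)

      -- Equality in a subspace ignores membership proofs, so `p` need not be the proof stored in
      -- `ps`.
      ∈-toList⁺ : ∀ {vs} (ps : All P vs) {x} {p : P x} → x ∈ₗ vs → (x , p) ∈ₚ All.toList ps
      ∈-toList⁺ (_ ∷ _)  (here x≈v) = here x≈v
      ∈-toList⁺ (_ ∷ ps) {p = p} (there x∈) = there (∈-toList⁺ ps {p = p} x∈)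

      ∈-toList⁻ : ∀ {vs} (ps : All P vs) {x} {p : P x} → (x , p) ∈ₚ All.toList ps → x ∈ₗ vs
      ∈-toList⁻ (_ ∷ _)  (here x≈v) = here x≈v
      ∈-toList⁻ (_ ∷ ps) {p = p} (there x∈) = there (∈-toList⁻ ps {p = p} x∈)

      Span-lift : ∀ {Q x} → Q ⊆ P → Span V Q x → (p : P x) → Span P-space (Q ∘ proj₁) (x , p)
      -- `go` builds its own membership proof along the derivation; reflexivity exchanges it for the
      -- given `p`.
      Span-lift {Q} Q⊆P s p = resp∈ ≈ᴹ-refl (proj₂ (go s))
        where
        go : ∀ {x} → Span V Q x → Σ[ p ∈ P x ] Span P-space (Q ∘ proj₁) (x , p)
        go (incl q)     = Q⊆P q , incl q
        go (resp∈ eq s) = P.resp eq (proj₁ (go s)) , resp∈ eq (proj₂ (go s))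
        go 0∈           = P.0-closed , 0∈
        go (s +∈ t)     = P.+-closed (proj₁ (go s)) (proj₁ (go t)) , proj₂ (go s) +∈ proj₂ (go t)
        go (c *∈ s)     = P.*-closed c (proj₁ (go s)) , c *∈ proj₂ (go s)

  -- Generated subalgebras and spans of multiplicative sets.

  module _ (A : Algebra) where
    open Algebra A hiding (zero)

    Generated-least : ∀ {S T} → S ⊆ Generated A T → Generated A S ⊆ Generated A T
    Generated-least S⊆ (incl s)     = S⊆ s
    Generated-least S⊆ (resp∈ eq p) = resp∈ eq (Generated-least S⊆ p)
    Generated-least S⊆ 0∈           = 0∈
    Generated-least S⊆ 1∈           = 1∈
    Generated-least S⊆ (p +∈ q)     = Generated-least S⊆ p +∈ Generated-least S⊆ q
    Generated-least S⊆ (p *∈ q)     = Generated-least S⊆ p *∈ Generated-least S⊆ q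
    Generated-least S⊆ (c •∈ p)     = c •∈ Generated-least S⊆ p

    Generated-mono : ∀ {S T} → S ⊆ T → Generated A S ⊆ Generated A T
    Generated-mono S⊆T = Generated-least (incl ∘ S⊆T)

    ⋃ : (ℕ → Pred Carrier ℓ) → Pred Carrier ℓ
    ⋃ E x = ∃[ n ] E n x

    Span-* : ∀ {P} → (∀ {x y} → P x → P y → P (x * y)) →
             ∀ {x y} → Span leftModule P x → Span leftModule P y → Span leftModule P (x * y)
    Span-* {P} P-* = go
      where
      goʳ : ∀ {x y} → P x → Span leftModule P y → Span leftModule P (x * y)
      goʳ p (incl q)     = incl (P-* p q)
      goʳ p (resp∈ eq t) = resp∈ (*-congˡ eq) (goʳ p t)
      goʳ p 0∈           = resp∈ (sym (zeroʳ _)) 0∈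
      goʳ p (s +∈ t)     = resp∈ (sym (distribˡ _ _ _)) (goʳ p s +∈ goʳ p t)
      goʳ p (c *∈ t)     = resp∈ (sym (*-•-comm c _ _)) (c *∈ goʳ p t)

      go : ∀ {x y} → Span leftModule P x → Span leftModule P y → Span leftModule P (x * y)
      go (incl p) t     = goʳ p t
      go (resp∈ eq s) t = resp∈ (*-congʳ eq) (go s t)
      go 0∈ t           = resp∈ (sym (zeroˡ _)) 0∈
      go (s +∈ s′) t    = resp∈ (sym (distribʳ _ _ _)) (go s t +∈ go s′ t)
      go (c *∈ s) t     = resp∈ (sym (•-*-assoc c _ _)) (c *∈ go s t)

    -- By bilinearity of the product, the span of a multiplicatively closed set containing 1 is
    -- already a subalgebra.
    Generated⊆Span : ∀ {S P} → S ⊆ P → P 1# → (∀ {x y} → P x → P y → P (x * y)) →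
                     Generated A S ⊆ Span leftModule P
    Generated⊆Span {S} {P} S⊆P P1 P-* = go
      where
      go : Generated A S ⊆ Span leftModule P
      go (incl s)     = incl (S⊆P s)
      go (resp∈ eq p) = resp∈ eq (go p)
      go 0∈           = 0∈
      go 1∈           = incl P1
      go (p +∈ q)     = go p +∈ go q
      go (p *∈ q)     = Span-* P-* (go p) (go q)
      go (c •∈ p)     = c *∈ go p

    -- Expansions as finite sums of components.

    Σ< : ℕ → (ℕ → Carrier) → Carrier
    Σ< m f = sum {m} (f ∘ toℕ)

    -- Asking for equality with all sufficiently long partial sums, rather than with
    -- one of them, lets expansions of different lengths be added without padding.
    record Expansion (E : ℕ → Pred Carrier ℓ) (x : Carrier) : Set ℓ where
      field
        component : ℕ → Carrier
        member    : ∀ n → E n (component n)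
        bound     : ℕ
        expand    : ∀ {m} → bound ℕ.≤ m → x ≈ Σ< m component

    -- Recursion on both indices replaces a test for equality: the tail of `single (suc n) x`
    -- reduces to `single n x`, in step with the unfolding of `sum`.
    single : ℕ → Carrier → ℕ → Carrier
    single zero    x zero    = x
    single zero    x (suc m) = 0#
    single (suc n) x zero    = 0#
    single (suc n) x (suc m) = single n x m

    single-self : ∀ n x → single n x n ≈ x
    single-self zero    x = refl
    single-self (suc n) x = single-self n x

    Σ<-single : ∀ {n m} x → n ℕ.< m → x ≈ Σ< m (single n x)
    Σ<-single {zero} {suc m} x _ =
      sym (trans (+-congˡ (Sum.sum-replicate-zero +-commutativeMonoid m)) (+-identityʳ x))
    Σ<-single {suc n} {suc m} x (s≤s n<m) =
      trans (Σ<-single x n<m) (sym (+-identityˡ _))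

    Σ<-• : ∀ m c (f : ℕ → Carrier) → c • Σ< m f ≈ Σ< m (λ n → c • f n)
    Σ<-• zero    c f = •-zeroʳ c
    Σ<-• (suc m) c f = trans (•-distribˡ c _ _) (+-congˡ (Σ<-• m c (f ∘ suc)))

    module _ {E : ℕ → Pred Carrier ℓ} (E-sub : ∀ n → IsSubspace leftModule (E n)) where
      open Expansion

      single-member : ∀ {n x} → E n x → Expansion E x
      single-member {n} {x} e = record
        { component = single n x
        ; member    = mem E (λ j → IsSubspace.0-closed (E-sub j)) n e
        -- A partial sum runs over indices below its length, so index `n` is first included at
        -- length `suc n`.
        ; bound     = suc n
        ; expand    = Σ<-single x
        }
        where
        -- The family is a variable here so that the recursive call can shift it together with the
        -- index.
        mem : ∀ (F : ℕ → Pred Carrier ℓ) → (∀ j → F j 0#) → ∀ n → F n x → ∀ j → F j (single n x j)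
        mem F F0 zero    e zero    = e
        mem F F0 zero    e (suc j) = F0 (suc j)
        mem F F0 (suc n) e zero    = F0 zero
        mem F F0 (suc n) e (suc j) = mem (F ∘ suc) (F0 ∘ suc) n e j

      Expansion-isSubspace : IsSubspace leftModule (Expansion E)
      Expansion-isSubspace = record
        { resp     = λ x≈y e → record
          { component = component e ; member = member e ; bound = bound e
          ; expand = λ le → trans (sym x≈y) (expand e le) }
        ; 0-closed = single-member {0} (IsSubspace.0-closed (E-sub 0))
        ; +-closed = λ e e′ → record
          { component = λ n → component e n + component e′ n
          ; member    = λ n → IsSubspace.+-closed (E-sub n) (member e n) (member e′ n)
          ; bound     = bound e ⊔ bound e′
          ; expand    = λ {m} le → trans
              (+-cong (expand e (≤-trans (m≤m⊔n (bound e) (bound e′)) le))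
                      (expand e′ (≤-trans (m≤n⊔m (bound e) (bound e′)) le)))
              (sym (Sum.∑-distrib-+ +-commutativeMonoid {m}
                (component e ∘ toℕ) (component e′ ∘ toℕ)))
          }
        ; *-closed = λ c e → record
          { component = λ n → c • component e n
          ; member    = λ n → IsSubspace.*-closed (E-sub n) c (member e n)
          ; bound     = bound e
          ; expand    = λ {m} le → trans (•-cong K.refl (expand e le)) (Σ<-• m c (component e))
          }
        }

      Span⋃⇒Expansion : Span leftModule (⋃ E) ⊆ Expansion E
      Span⋃⇒Expansion = Span-least leftModule Expansion-isSubspace (single-member ∘ proj₂)

  -- Homogeneous components and the degree-1 part of a generated subalgebra.

  module _ (A : GradedAlgebra) where
    open GradedAlgebra A
    open AbelianGroupProperties +-abelianGroup using (x∙y⁻¹≈ε⇒x≈y)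
    open Expansion

    Expansion-0 : ∀ {x} (e : Expansion algebra Deg x) → x ≈ 0# → ∀ n → component e n ≈ 0#
    Expansion-0 e x≈0 n = ≡.subst (λ j → component e j ≈ 0#) (toℕ-fromℕ< n<m)
      (independent {m} (component e ∘ toℕ) (member e ∘ toℕ)
        (trans (sym (expand e (m≤m⊔n (bound e) (suc n)))) x≈0) (fromℕ< n<m))
      where
      -- The length must reach the bound for the expansion to be valid, and exceed `n` for `n` to be
      -- an index to which `independent` applies.
      m   = bound e ⊔ suc n
      n<m = m≤n⊔m (bound e) (suc n)

    -- Besides its expansion along `E`, the element `x` has one concentrated in degree `n`. Their
    -- difference expands 0, so the two components in degree `n` agree and `x` inherits membership
    -- in `E n`.
    homogeneous-component : ∀ {E} → (∀ n → IsSubspace leftModule (E n)) → (∀ n → E n ⊆ Deg n) →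
                            ∀ {n x} → Deg n x → Span leftModule (⋃ algebra E) x → E n x
    homogeneous-component {E} E-sub E⊆Deg {n} {x} d s =
      IsSubspace.resp (E-sub n) eₙ≈x (member e n)
      where
      e : Expansion algebra E x
      e = Span⋃⇒Expansion algebra E-sub s

      -1•x≈-x : ∀ y → (K.- K.1#) • y ≈ - y
      -1•x≈-x = -1*ₗx≈-ᴹx leftModule

      -- Expansions are closed under sums and scalar multiples, so the difference is formed with the
      -- scalar -1.
      x-x : Expansion algebra Deg (x + (K.- K.1#) • x)
      x-x = IsSubspace.+-closed sub
        (record { component = component e ; member = λ j → E⊆Deg j (member e j)
                ; bound = bound e ; expand = expand e })
        (IsSubspace.*-closed sub (K.- K.1#) (single-member algebra isSubspace d))
        where sub = Expansion-isSubspace algebra isSubspace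

      eₙ≈x : component e n ≈ x
      eₙ≈x = x∙y⁻¹≈ε⇒x≈y _ _ (trans
        (+-congˡ (sym (trans (-1•x≈-x _) (-‿cong (single-self algebra n x)))))
        (Expansion-0 x-x (trans (+-congˡ (-1•x≈-x x)) (-‿inverseʳ x)) n))

    Generated∩Deg1 : IsConnected A → ∀ {W} → IsSubspace leftModule W → W ⊆ Deg 1 →
                     ∀ {x} → Generated algebra W x → Deg 1 x → W x
    Generated∩Deg1 conn {W} W-sub W⊆A₁ g d = homogeneous-component {E} E-sub E⊆Deg d
      (Generated⊆Span algebra (1 ,_) (0 , 1-degree) ⋃E-* g)
      where
      module W = IsSubspace W-sub

      E : ℕ → Pred Carrier ℓ
      E 1 = W
      E n = Deg n

      -- `E n` computes only once `n` is known to be 0, 1 or at least 2, which dictates the case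
      -- splits below.
      E-sub : ∀ n → IsSubspace leftModule (E n)
      E-sub 0             = isSubspace 0
      E-sub 1             = W-sub
      E-sub (suc (suc n)) = isSubspace (2 ℕ.+ n)

      E⊆Deg : ∀ n → E n ⊆ Deg n
      E⊆Deg 0             = id
      E⊆Deg 1             = W⊆A₁
      E⊆Deg (suc (suc n)) = id

      scalarˡ : ∀ {a w} → Deg 0 a → W w → W (a * w)
      scalarˡ a∈ w∈ with IsConnected.surjective conn a∈
      ... | c , c1≈a = W.resp (trans (sym (trans (•-*-assoc c _ _) (•-cong K.refl (*-identityˡ _))))
                                     (*-congʳ c1≈a)) (W.*-closed c w∈)

      scalarʳ : ∀ {a w} → W w → Deg 0 a → W (w * a)
      scalarʳ w∈ a∈ with IsConnected.surjective conn a∈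
      ... | c , c1≈a = W.resp (trans (sym (trans (*-•-comm c _ _) (•-cong K.refl (*-identityʳ _))))
                                     (*-congˡ c1≈a)) (W.*-closed c w∈)

      E-* : ∀ m n {x y} → E m x → E n y → E (m ℕ.+ n) (x * y)
      E-* 0             0             p q = *-degree p q
      E-* 0             1             p q = scalarˡ p q
      E-* 0             (suc (suc n)) p q = *-degree p q
      E-* 1             0             p q = scalarʳ p q
      -- From here on the total degree is at least 2, where `E` is the whole component, so
      -- membership in `Deg` suffices.
      E-* 1             (suc n)       p q = *-degree (W⊆A₁ p) (E⊆Deg (suc n) q)
      E-* (suc (suc m)) n             p q = *-degree p (E⊆Deg n q)

      ⋃E-* : ∀ {x y} → ⋃ algebra E x → ⋃ algebra E y → ⋃ algebra E (x * y)
      ⋃E-* (m , p) (n , q) = m ℕ.+ n , E-* m n p q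

    -- The directed system of subalgebras generated by finite lists.

    open Membership setoid renaming (_∈_ to _∈ₗ_)

    -- Lists keep the index set at level `ℓ`; the subspaces themselves, being predicates, would form
    -- a type one level higher.
    Degree1List : Set ℓ
    Degree1List = Σ[ vs ∈ List Carrier ] All (Deg 1) vs

    ⟨_⟩ₗ : Degree1List → Pred Carrier ℓ
    ⟨ vs , _ ⟩ₗ = Span leftModule (_∈ₗ vs)

    ⟨⟩ₗ⊆A₁ : ∀ l → ⟨ l ⟩ₗ ⊆ Deg 1
    ⟨⟩ₗ⊆A₁ (_ , ds) = Span-least leftModule (isSubspace 1) (All-∈ leftModule (isSubspace 1) ds)

    subalgebraₗ : Degree1List → GradedSubalgebra A
    subalgebraₗ l = generatedSubalgebra A ⟨ l ⟩ₗ (⟨⟩ₗ⊆A₁ l)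

    -- The list itself, with its entries viewed inside the subalgebra, spans the degree-1 part: by
    -- `Generated∩Deg1` a degree-1 element lies in the span of `vs` in `A`, and `Span-lift` carries
    -- this span into the subalgebra.
    subalgebraₗ-finiteType : IsConnected A → ∀ l → FiniteType (asGradedAlgebra (subalgebraₗ l))
    subalgebraₗ-finiteType conn l@(vs , ds) = All.toList gens ,
      (λ {(_ , g)} d → Span-mono B-space
        (λ {(_ , p)} → ∈-toList⁺ leftModule G-sub gens {p = p})
        (Span-lift leftModule G-sub (λ x∈ → incl (incl x∈)) (Generated∩Deg1 conn
          (Span-isSubspace leftModule _) (⟨⟩ₗ⊆A₁ l) g d) g)) ,
      Span-least B-space (GradedAlgebra.isSubspace B 1)
        (λ {(_ , p)} x∈ → ⟨⟩ₗ⊆A₁ l (incl (∈-toList⁻ leftModule G-sub gens {p = p} x∈)))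
      where
      B       = asGradedAlgebra (subalgebraₗ l)
      B-space = GradedAlgebra.leftModule B
      G-sub   = GradedSubalgebra.isSubspace (subalgebraₗ l)

      gens : All (Generated algebra ⟨ l ⟩ₗ) vs
      gens = All.tabulateₛ setoid (λ x∈ → incl (incl x∈))

    infixr 5 _++ₗ_
    _++ₗ_ : Degree1List → Degree1List → Degree1List
    (vs , ds) ++ₗ (ws , es) = vs ++ ws , ++⁺ ds es

    ++ₗ-upperˡ : ∀ l l′ → Generated algebra ⟨ l ⟩ₗ ⊆ Generated algebra ⟨ l ++ₗ l′ ⟩ₗ
    ++ₗ-upperˡ _ _ = Generated-mono algebra (Span-mono leftModule (∈-++⁺ˡ setoid))

    ++ₗ-upperʳ : ∀ l l′ → Generated algebra ⟨ l′ ⟩ₗ ⊆ Generated algebra ⟨ l ++ₗ l′ ⟩ₗ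
    ++ₗ-upperʳ (vs , _) _ = Generated-mono algebra (Span-mono leftModule (∈-++⁺ʳ setoid vs))

    -- A derivation from degree-1 elements uses only finitely many of them; the list collects its
    -- leaves, concatenating at sums and products.
    covering-list : ∀ {a} → Generated algebra (Deg 1) a → ∃[ l ] Generated algebra ⟨ l ⟩ₗ a
    covering-list (incl {x} d) = ([ x ] , d ∷ []) , incl (incl (here refl))
    covering-list (resp∈ eq p) with covering-list p
    ... | l , g = l , resp∈ eq g
    covering-list 0∈ = ([] , []) , 0∈
    covering-list 1∈ = ([] , []) , 1∈
    covering-list (p +∈ q) with covering-list p | covering-list q
    ... | l , g | l′ , g′ = l ++ₗ l′ , (++ₗ-upperˡ l l′ g +∈ ++ₗ-upperʳ l l′ g′)
    covering-list (p *∈ q) with covering-list p | covering-list q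
    ... | l , g | l′ , g′ = l ++ₗ l′ , (++ₗ-upperˡ l l′ g *∈ ++ₗ-upperʳ l l′ g′)
    covering-list (c •∈ p) with covering-list p
    ... | l , g = l , (c •∈ g)

    subalgebraₗ-isDirectedUnion : GeneratedInDegree1 A → IsDirectedUnion A subalgebraₗ
    subalgebraₗ-isDirectedUnion gen = record
      { nonempty = [] , []
      ; directed = λ l l′ → l ++ₗ l′ , ++ₗ-upperˡ l l′ , ++ₗ-upperʳ l l′
      ; covers   = λ a → covering-list (gen a)
      }

proposition4p1 : ∀ {ℓ : Level} (k : HeytingField ℓ ℓ ℓ) → let open GradedAlgebras k in
    (A : GradedAlgebra) → let open GradedAlgebra A in
    IsConnected A → GradedCommutative A → IsQuadratic A →
    (∀ (W : Pred Carrier ℓ) → IsSubspace leftModule W → FiniteDimensional leftModule W →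
    (W⊆A₁ : W ⊆ Deg 1) → let B_W = asGradedAlgebra (generatedSubalgebra A W W⊆A₁) in
    IsQuadratic B_W × UniversallyKoszul B_W) →
    Σ[ I ∈ Set ℓ ] Σ[ B ∈ (I → GradedSubalgebra A) ]
    IsDirectedUnion A B ×
    (∀ i → let Bᵢ = asGradedAlgebra (B i) in
    IsQuadratic Bᵢ × FiniteType Bᵢ × UniversallyKoszul Bᵢ)
proposition4p1 k A conn _ quad hyp =
  Degree1List k A , subalgebraₗ k A ,
  subalgebraₗ-isDirectedUnion k A (IsQuadratic.generatedInDegree1 quad) ,
  λ l → let quadₗ , koszulₗ = hyp (⟨_⟩ₗ k A l) (Span-isSubspace k leftModule _)
                                   -- The subspace is by definition the span of the list, so the
                                   -- list witnesses finite dimension with identity inclusions.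
                                   (proj₁ l , id , id) (⟨⟩ₗ⊆A₁ k A l)
        in quadₗ , subalgebraₗ-finiteType k A conn l , koszulₗ
  where
  open GradedAlgebras k
  open GradedAlgebra A using (leftModule)
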